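{- Let $N$ be a composite number with $N=\prod_{i=1}^{a}p_i^{2n_i}\prod_{j=1}^{b}q_j^{2m_j+1}$, where $p_1,\ldots,p_a,q_1,\ldots,q_b$ are distinct primes, $n_i\geq 1$ and $m_j\geq 0$ are integers. Then $box(\Gamma(\mathbb{Z}_N))\leq \prod_{i=1}^{a}(2n_i+1)\prod_{j=1}^{b}(2m_j+2)-\prod_{i=1}^{a}(n_i+1)\prod_{j=1}^{b}(m_j+1)-1.$
   Context: $\mathbb{Z}_N$ is the ring of integers modulo $N$. The zero-divisor graph $\Gamma(R)$ of a ring $R$ has as vertices the non-zero zero-divisors of $R$, two distinct vertices $x,y$ being adjacent iff $xy=0$. The boxicity $box(G)$ is the least positive integer $\ell$ such that $G$ is isomorphic to the intersection graph of a family of $\ell$-boxes (Cartesian products of $\ell$ closed bounded real intervals).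
   Formalization: The case where N is the square of a prime is excluded: there the zero-divisor graph is complete, its boxicity (a least positive integer) is 1, and the stated bound is 3−2−1=0, so the claim fails exactly for these N. -}

module Defs where

open import Algebra.Bundles using (CommutativeRing)
open import Data.Fin.Base using (Fin)
open import Data.Integer.Base using (ℤ; +_; 0ℤ; 1ℤ; _+_; _*_; -_; _-_)
open import Data.Integer.Divisibility.Signed
  using (_∣_; divides; ∣m∣n⇒∣m+n; ∣m⇒∣-m; ∣m⇒∣m*n; ∣n⇒∣m*n)
import Data.Integer.Properties as ℤ
open import Data.Integer.Tactic.RingSolver using (solve-∀)
open import Data.List.Base using (product; tabulate)
open import Data.Nat.Base as ℕ using (ℕ)
open import Data.Product.Base using (Σ; ∃; ∃-syntax; _×_; _,_; proj₁; swap)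
open import Data.Rational.Base as ℚ using (ℚ)
open import Data.Sum.Base using (_⊎_)
open import Function.Base using (_∘_)
open import Function.Bundles using (Inverse; _⇔_)
open import Level using (Level; suc; _⊔_; 0ℓ)
open import Relation.Binary.Bundles using (Setoid)
open import Relation.Binary.Core using (Rel)
open import Relation.Binary.Definitions using (Irreflexive; Symmetric; _Respects₂_)
open import Relation.Binary.PropositionalEquality
  using (_≡_; _≢_; refl; subst; setoid; ≢-sym)
import Relation.Binary.Construct.On as On
open import Relation.Nullary.Negation using (¬_)
open import Relation.Unary using (Pred)

private
  variable
    a b ℓ a′ b′ ℓ′ : Level

∏ : ∀ {n} → (Fin n → ℕ) → ℕ
∏ f = product (tabulate f)

-- Dedekind cuts: Lower and Upper are the sets of rationals strictly below,
-- respectively strictly above, the number.  Two cuts are the same real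
-- number when each is ≤ᴿ the other.
record ℝ : Set₁ where
  field
    Lower Upper     : Pred ℚ 0ℓ
    lower-inhabited : ∃ Lower
    upper-inhabited : ∃ Upper
    lower-rounded   : ∀ q → Lower q ⇔ (∃[ r ] (q ℚ.< r × Lower r))
    upper-rounded   : ∀ q → Upper q ⇔ (∃[ r ] (r ℚ.< q × Upper r))
    disjoint        : ∀ q → ¬ (Lower q × Upper q)
    located         : ∀ {q r} → q ℚ.< r → Lower q ⊎ Upper r

infix 4 _≤ᴿ_

_≤ᴿ_ : Rel ℝ 0ℓ
x ≤ᴿ y = ∀ q → ℝ.Lower x q → ℝ.Lower y q

record Graph (a b ℓ : Level) : Set (suc (a ⊔ b ⊔ ℓ)) where
  field
    vertices : Setoid a b

  open Setoid vertices public renaming (Carrier to Vertex) using (_≈_)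

  field
    Adj        : Rel Vertex ℓ
    Adj-resp   : Adj Respects₂ _≈_
    Adj-sym    : Symmetric Adj
    Adj-irrefl : Irreflexive _≈_ Adj

record _≅_ (G : Graph a b ℓ) (H : Graph a′ b′ ℓ′)
       : Set (a ⊔ b ⊔ ℓ ⊔ a′ ⊔ b′ ⊔ ℓ′) where
  private
    module G = Graph G
    module H = Graph H

  field
    bijection : Inverse G.vertices H.vertices

  open Inverse bijection using (to)

  field
    preserves : ∀ x y → G.Adj x y ⇔ H.Adj (to x) (to y)

record Interval : Set₁ where
  field
    left right : ℝ
    left≤right : left ≤ᴿ right

_∈ᴵ_ : ℝ → Interval → Set
x ∈ᴵ I = Interval.left I ≤ᴿ x × x ≤ᴿ Interval.right I

Box : ℕ → Set₁
Box d = Fin d → Interval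

_∈ᴮ_ : ∀ {d} → (Fin d → ℝ) → Box d → Set
x ∈ᴮ B = ∀ i → x i ∈ᴵ B i

Intersect : ∀ {d} → Rel (Box d) (suc 0ℓ)
Intersect B C = ∃[ x ] (x ∈ᴮ B × x ∈ᴮ C)

intersectionGraph : ∀ {d} {I : Set} → (I → Box d) → Graph 0ℓ 0ℓ (suc 0ℓ)
intersectionGraph {I = I} B = record
  { vertices   = setoid I
  ; Adj        = λ i j → i ≢ j × Intersect (B i) (B j)
  ; Adj-resp   = (λ { refl p → p }) , (λ { refl p → p })
  ; Adj-sym    = λ (i≢j , x , x∈) → ≢-sym i≢j , x , swap x∈
  ; Adj-irrefl = λ i≡j (i≢j , _) → i≢j i≡j
  }

BoxRepresentable : Graph a b ℓ → ℕ → Set (a ⊔ b ⊔ ℓ ⊔ suc 0ℓ)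
BoxRepresentable G d =
  Σ Set λ I → Σ (I → Box d) λ B → G ≅ intersectionGraph B

record IsBoxicity (G : Graph a b ℓ) (d : ℕ) : Set (a ⊔ b ⊔ ℓ ⊔ suc 0ℓ) where
  field
    positive      : 1 ℕ.≤ d
    representable : BoxRepresentable G d
    least         : ∀ d′ → 1 ℕ.≤ d′ → BoxRepresentable G d′ → d ℕ.≤ d′

module _ (R : CommutativeRing a ℓ) where
  open CommutativeRing R
    using (Carrier; _≈_; 0#; *-comm; *-congˡ; *-congʳ)
    renaming (_*_ to _·_; sym to ≈-sym; trans to ≈-trans)

  IsZeroDivisor : Carrier → Set (a ⊔ ℓ)
  IsZeroDivisor x = ∃[ y ] (¬ y ≈ 0# × x · y ≈ 0#)

  NonZeroZeroDivisor : Set (a ⊔ ℓ)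
  NonZeroZeroDivisor = ∃[ x ] (¬ x ≈ 0# × IsZeroDivisor x)

  -- Vertices are compared as ring elements, so the witness of being a
  -- zero-divisor is immaterial.
  zeroDivisorGraph : Graph (a ⊔ ℓ) ℓ ℓ
  zeroDivisorGraph = record
    { vertices   = On.setoid {B = NonZeroZeroDivisor} (CommutativeRing.setoid R) proj₁
    ; Adj        = λ (x , _) (y , _) → ¬ x ≈ y × x · y ≈ 0#
    ; Adj-resp   =
        (λ y≈z (x≉y , xy≈0) →
          (λ x≈z → x≉y (≈-trans x≈z (≈-sym y≈z))) ,
          ≈-trans (*-congˡ (≈-sym y≈z)) xy≈0) ,
        (λ x≈z (x≉y , xy≈0) →
          (λ z≈y → x≉y (≈-trans x≈z z≈y)) ,
          ≈-trans (*-congʳ (≈-sym x≈z)) xy≈0)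
    ; Adj-sym    = λ (x≉y , xy≈0) →
        (λ y≈x → x≉y (≈-sym y≈x)) , ≈-trans (*-comm _ _) xy≈0
    ; Adj-irrefl = λ x≈y (x≉y , _) → x≉y x≈y
    }

module _ (N : ℕ) where
  infix 4 _≡ᴺ_

  _≡ᴺ_ : Rel ℤ 0ℓ
  x ≡ᴺ y = + N ∣ x - y

  private
    reflexive : ∀ {x y} → x ≡ y → x ≡ᴺ y
    reflexive {x} refl = divides 0ℤ (ℤ.+-inverseʳ x)

    sym-eq : ∀ x y → - (x - y) ≡ y - x
    sym-eq = solve-∀

    trans-eq : ∀ x y z → (x - y) + (y - z) ≡ x - z
    trans-eq = solve-∀

    +-eq : ∀ x y u v → (x - y) + (u - v) ≡ (x + u) - (y + v)
    +-eq = solve-∀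

    *-eq : ∀ x y u v → (x - y) * u + y * (u - v) ≡ x * u - y * v
    *-eq = solve-∀

    neg-eq : ∀ x y → - (x - y) ≡ - x - - y
    neg-eq = solve-∀

  ℤ/ : CommutativeRing 0ℓ 0ℓ
  ℤ/ = record
    { Carrier = ℤ
    ; _≈_ = _≡ᴺ_
    ; _+_ = _+_
    ; _*_ = _*_
    ; -_  = -_
    ; 0#  = 0ℤ
    ; 1#  = 1ℤ
    ; isCommutativeRing = record
      { isRing = record
        { +-isAbelianGroup = record
          { isGroup = record
            { isMonoid = record
              { isSemigroup = record
                { isMagma = record
                  { isEquivalence = record
                    { refl  = λ {x} → reflexive {x} refl
                    ; sym   = λ {x} {y} p → subst (+ N ∣_) (sym-eq x y) (∣m⇒∣-m p)
                    ; trans = λ {x} {y} {z} p q →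
                        subst (+ N ∣_) (trans-eq x y z) (∣m∣n⇒∣m+n p q)
                    }
                  ; ∙-cong = λ {x} {y} {u} {v} p q →
                      subst (+ N ∣_) (+-eq x y u v) (∣m∣n⇒∣m+n p q)
                  }
                ; assoc = λ x y z → reflexive (ℤ.+-assoc x y z)
                }
              ; identity = reflexive ∘ ℤ.+-identityˡ , reflexive ∘ ℤ.+-identityʳ
              }
            ; inverse = reflexive ∘ ℤ.+-inverseˡ , reflexive ∘ ℤ.+-inverseʳ
            ; ⁻¹-cong = λ {x} {y} p → subst (+ N ∣_) (neg-eq x y) (∣m⇒∣-m p)
            }
          ; comm = λ x y → reflexive (ℤ.+-comm x y)
          }
        ; *-cong = λ {x} {y} {u} {v} p q →
            subst (+ N ∣_) (*-eq x y u v) (∣m∣n⇒∣m+n (∣m⇒∣m*n u p) (∣n⇒∣m*n y q))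
        ; *-assoc = λ x y z → reflexive (ℤ.*-assoc x y z)
        ; *-identity = reflexive ∘ ℤ.*-identityˡ , reflexive ∘ ℤ.*-identityʳ
        ; distrib = (λ x y z → reflexive (ℤ.*-distribˡ-+ x y z)) ,
                    (λ x y z → reflexive (ℤ.*-distribʳ-+ x y z))
        }
      ; *-comm = λ x y → reflexive (ℤ.*-comm x y)
      }
    }

{-# OPTIONS --safe #-}

-- The vertices of Γ(ℤ_N) fall into classes according to d = gcd(x, N), and x y = 0
-- iff N ∣ d y.  If N ∣ d² and N ∣ e² then N ∣ d e, so in a non-adjacent pair one
-- of the two classes d satisfies N ∤ d²; such a class is independent.  For each such
-- d ≠ 1, the interval graph in which the elements of the class d are distinct points
-- x + 1, the elements y with d y = 0 are [0, N], and all others are the point 0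
-- contains Γ(ℤ_N) and has no edge between the class and its non-neighbours.  The
-- intersection of these interval graphs is Γ(ℤ_N), and their number is the number of
-- divisors, minus the number of divisors d with N ∣ d², minus 1.
--
-- The least dimension exists constructively because, on a finite graph with decidable
-- adjacency, being the intersection graph of d-boxes is decidable: the endpoints may
-- be taken among finitely many integers.

module Submission where

open import Algebra.Bundles using (CommutativeRing)
open import Data.Fin.Base as Fin using (Fin; zero; suc; toℕ; fromℕ<; funToFin; finToFun)
open import Data.Fin.Properties as Fin using (toℕ-fromℕ<; finToFun-funToFin; any?; all?; sequence)
open import Data.Fin.Subset using (Subset; ∣_∣) renaming (_∈_ to _∈ˢ_)
open import Data.Fin.Subset.Properties using (p⊆q⇒∣p∣≤∣q∣; p⊂q⇒∣p∣<∣q∣; ∣p∣≤n)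
open import Data.Integer.Base as ℤ using (ℤ; +_; -[1+_]; 0ℤ; 1ℤ)
import Data.Integer.Divisibility.Signed as ℤ
open import Data.Integer.DivMod using (_%ℕ_; _/ℕ_; n%ℕd<d; a≡a%ℕn+[a/ℕn]*n)
import Data.Integer.Properties as ℤ
open import Data.Integer.Tactic.RingSolver using (solve-∀)
open import Data.List.Base
  using (List; []; _∷_; _++_; length; lookup; map; filter; upTo; applyUpTo; tabulate;
         cartesianProductWith)
open import Data.List.Properties
  using (length-++; length-map; length-applyUpTo; length-upTo; filter-notAll; map-++;
         map-tabulate; tabulate-cong)
open import Data.List.Membership.Propositional using (_∈_; lose)
open import Data.List.Membership.Propositional.Properties
  using (∈-cartesianProductWith⁺; ∈-upTo⁺; ∈-upTo⁻; ∈-applyUpTo⁺; ∈-++⁺ˡ; ∈-++⁺ʳ;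
         ∈-filter⁺; ∈-filter⁻; ∈-lookup)
open import Data.List.Relation.Unary.All as All using (All; []; _∷_)
import Data.List.Relation.Unary.All.Properties as All
open import Data.List.Relation.Unary.AllPairs using (_∷_)
open import Data.List.Relation.Unary.Any as Any using (here)
open import Data.List.Relation.Unary.Any.Properties using (lookup-index)
open import Data.List.Relation.Unary.Unique.Propositional using (Unique)
import Data.List.Relation.Unary.Unique.Propositional.Properties as Unique
open import Data.Nat.Base
open import Data.Nat.Coprimality
  using (Coprime; coprime-divisor; coprime-factors; gcd≡1⇒coprime; 1-coprimeTo)
  renaming (sym to coprime-sym)
open import Data.Nat.Divisibility
open import Data.Nat.GCD
open import Data.Nat.ListAction using (product)
open import Data.Nat.ListAction.Properties using (product-++)
open import Data.Nat.Primality
open import Data.Nat.Properties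
import Data.Nat.Tactic.RingSolver as ℕ
open import Data.Product.Base using (Σ; ∃-syntax; _×_; _,_; proj₁; proj₂)
open import Data.Rational.Base as ℚ using (ℚ; mkℚ; *<*; *≤*)
import Data.Rational.Properties as ℚ
open import Data.Sum.Base using (_⊎_; inj₁; inj₂; [_,_])
import Data.Vec.Base as Vec
open import Data.Vec.Properties using ([]=⇒lookup; lookup⇒[]=; lookup∘tabulate)
open import Effect.Monad using (RawMonad)
open import Function.Base using (_∘_; id)
open import Function.Bundles using (Inverse; _⇔_; mk⇔; Equivalence)
open import Function.Definitions using (Injective)
open import Level using (Level)
open import Relation.Binary.Bundles using (Setoid)
open import Relation.Binary.Definitions
  using (tri<; tri≈; tri>) renaming (Decidable to Decidable₂)
open import Relation.Binary.PropositionalEquality hiding ([_])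
open import Relation.Nullary.Decidable
  using (Dec; yes; no; does; map′; dec-true; _×-dec_; _→-dec_; ¬?; decidable-stable;
         ¬¬-excluded-middle)
open import Relation.Nullary.Negation using (¬_; contradiction; ¬¬-Monad; ¬¬-map)
open import Relation.Unary using (Pred; Decidable)
open import Defs

open Equivalence using (to; from)

-- Boxicity of finite graphs

private
  variable
    a b ℓ : Level
    n d : ℕ

least : ∀ {P : Pred ℕ ℓ} → Decidable P → ∀ k → P k →
        ∃[ m ] (P m × m ≤ k × (∀ m′ → P m′ → m ≤ m′))
least P? k Pk with P? 0
... | yes P0 = 0 , P0 , z≤n , λ _ _ → z≤n
least P? zero Pk | no ¬P0 = contradiction Pk ¬P0
least P? (suc k) Pk | no ¬P0 with least (P? ∘ suc) k Pk
... | m , Pm , m≤k , min = suc m , Pm , s≤s m≤k , λ where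
  zero     P0 → contradiction P0 ¬P0
  (suc m′) Pm′ → s≤s (min m′ Pm′)

-- Double negation commutes with finite conjunction. This permits finitely many undecidable
-- comparisons of reals to be decided at once while a stable statement is being proved.
¬¬-choice : {P : Fin n → Set ℓ} → (∀ i → ¬ ¬ P i) → ¬ ¬ (∀ i → P i)
¬¬-choice = sequence (RawMonad.rawApplicative ¬¬-Monad)

module _ {P : Pred (Fin n) ℓ} (P? : Decidable P) where
  ⟦_⟧ : Subset n
  ⟦_⟧ = Vec.tabulate (does ∘ P?)

  ∈⟦⟧⁺ : ∀ {i} → P i → i ∈ˢ ⟦_⟧
  ∈⟦⟧⁺ {i} Pi = lookup⇒[]= i _ (trans (lookup∘tabulate _ i) (dec-true (P? i) Pi))

  ∈⟦⟧⁻ : ∀ {i} → i ∈ˢ ⟦_⟧ → P i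
  ∈⟦⟧⁻ {i} i∈ with P? i | trans (sym (lookup∘tabulate (does ∘ P?) i)) ([]=⇒lookup i∈)
  ... | yes Pi | _ = Pi

-- Order on the Dedekind reals and the embedding of the naturals

≤ᴿ-trans : ∀ x y z → x ≤ᴿ y → y ≤ᴿ z → x ≤ᴿ z
≤ᴿ-trans _ _ _ x≤y y≤z q = y≤z q ∘ x≤y q

≤ᴿ-refl : ∀ x → x ≤ᴿ x
≤ᴿ-refl _ _ = id

lower-closed : ∀ x {p q} → p ℚ.< q → ℝ.Lower x q → ℝ.Lower x p
lower-closed x p<q Lq = from (ℝ.lower-rounded x _) (_ , p<q , Lq)

lower<upper : ∀ x {p q} → ℝ.Lower x p → ℝ.Upper x q → p ℚ.< q
lower<upper x {p} {q} Lp Uq with ℚ.<-cmp p q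
... | tri< p<q _ _ = p<q
... | tri≈ _ refl _ = contradiction (Lp , Uq) (ℝ.disjoint x p)
... | tri> _ _ q<p = contradiction (lower-closed x q<p Lp , Uq) (ℝ.disjoint x q)

-- Given `q` below `y`, roundedness gives `r` with `q < r` below `y`, and `x` is located between
-- them. If `r` were above `x`, all of `x` would lie below `r` and hence below `y`. No decidability
-- of the order is used.
≰ᴿ⇒≥ᴿ : ∀ x y → ¬ x ≤ᴿ y → y ≤ᴿ x
≰ᴿ⇒≥ᴿ x y x≰y q Lyq with to (ℝ.lower-rounded y q) Lyq
... | r , q<r , Lyr with ℝ.located x q<r
...   | inj₁ Lxq = Lxq
...   | inj₂ Uxr = contradiction
  (λ p Lxp → lower-closed y (lower<upper x Lxp Uxr) Lyr) x≰y

fromℤ : ℤ → ℚ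
fromℤ i = mkℚ i 0 (coprime-sym (1-coprimeTo ℤ.∣ i ∣))

fromℤ-mono-≤ : ∀ {i j} → i ℤ.≤ j → fromℤ i ℚ.≤ fromℤ j
fromℤ-mono-≤ i≤j = *≤* (ℤ.*-monoʳ-≤-nonNeg 1ℤ i≤j)

fromℤ-mono-< : ∀ {i j} → i ℤ.< j → fromℤ i ℚ.< fromℤ j
fromℤ-mono-< i<j = *<* (ℤ.*-monoʳ-<-pos 1ℤ i<j)

fromℕᴿ : ℕ → ℝ
fromℕᴿ k = record
  { Lower = ℚ._< ι
  ; Upper = ι ℚ.<_
  ; lower-inhabited = fromℤ -[1+ 0 ] , fromℤ-mono-< ℤ.-<+
  ; upper-inhabited = fromℤ (+ suc k) , fromℤ-mono-< (ℤ.+<+ (n<1+n k))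
  ; lower-rounded = λ q → mk⇔
      (λ q<ι → let r , q<r , r<ι = ℚ.<-dense q<ι in r , q<r , r<ι)
      (λ (_ , q<r , r<ι) → ℚ.<-trans q<r r<ι)
  ; upper-rounded = λ q → mk⇔
      (λ ι<q → let r , ι<r , r<q = ℚ.<-dense ι<q in r , r<q , ι<r)
      (λ (_ , r<q , ι<r) → ℚ.<-trans ι<r r<q)
  ; disjoint = λ _ (q<ι , ι<q) → ℚ.<-asym q<ι ι<q
  ; located = located
  }
  where
  ι : ℚ
  ι = fromℤ (+ k)

  located : ∀ {q r} → q ℚ.< r → q ℚ.< ι ⊎ ι ℚ.< r
  located {q} q<r with q ℚ.<? ι
  ... | yes q<ι = inj₁ q<ι
  ... | no  q≮ι = inj₂ (ℚ.≤-<-trans (ℚ.≮⇒≥ q≮ι) q<r)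

fromℕᴿ-mono : ∀ {k l} → k ≤ l → fromℕᴿ k ≤ᴿ fromℕᴿ l
fromℕᴿ-mono k≤l _ q<k = ℚ.<-≤-trans q<k (fromℤ-mono-≤ (ℤ.+≤+ k≤l))

fromℕᴿ-reflects : ∀ k l → fromℕᴿ k ≤ᴿ fromℕᴿ l → k ≤ l
fromℕᴿ-reflects k l k≤l with k ≤? l
... | yes p = p
... | no  p = contradiction (k≤l _ (fromℤ-mono-< (ℤ.+<+ (≰⇒> p)))) (ℚ.<-irrefl refl)

-- Replacing real endpoints by integers

Discretisation : (L R : Fin n → ℝ) → Set
Discretisation {n} L R = Σ (Fin n → Fin (suc n)) λ L′ → Σ (Fin n → Fin (suc n)) λ R′ →
  ∀ u v → L u ≤ᴿ R v ⇔ toℕ (L′ u) ≤ toℕ (R′ v)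

-- Every endpoint is replaced by the number of left endpoints not above it.
discretise : (L R : Fin n → ℝ) → ¬ ¬ Discretisation L R
discretise {n} L R = ¬¬-map build
  (¬¬-choice λ w → ¬¬-choice λ u → λ k →
    ¬¬-excluded-middle λ x → ¬¬-excluded-middle λ y → k (x , y))
  where
  build : (∀ w u → Dec (L w ≤ᴿ L u) × Dec (L w ≤ᴿ R u)) → Discretisation L R
  build dec = rank ∘ below-L , rank ∘ below-R , λ u v → mk⇔
    (λ Lu≤Rv → subst₂ _≤_ (sym (toℕ-rank (below-L u))) (sym (toℕ-rank (below-R v)))
      (p⊆q⇒∣p∣≤∣q∣ (λ {w} w∈ →
        ∈⟦⟧⁺ (R? v) (≤ᴿ-trans (L w) (L u) (R v) (∈⟦⟧⁻ (L? u) w∈) Lu≤Rv))))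
    -- If `R v` lies below `L u`, the left endpoints not above `R v` are also not above `L u`, and
    -- `u` itself is counted only for the latter. The ranks would then be strictly ordered the other
    -- way.
    (λ rank≤ → decidable-stable (R? v u) λ Lu≰Rv → <⇒≱
      (p⊂q⇒∣p∣<∣q∣ ( (λ {w} w∈ → ∈⟦⟧⁺ (L? u) (≤ᴿ-trans (L w) (R v) (L u)
                      (∈⟦⟧⁻ (R? v) w∈) (≰ᴿ⇒≥ᴿ (L u) (R v) Lu≰Rv)))
                   , u , ∈⟦⟧⁺ (L? u) (≤ᴿ-refl (L u)) , Lu≰Rv ∘ ∈⟦⟧⁻ (R? v)))
      (subst₂ _≤_ (toℕ-rank (below-L u)) (toℕ-rank (below-R v)) rank≤))
    where
    rank : Subset n → Fin (suc n)
    rank p = fromℕ< (s≤s (∣p∣≤n p))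

    toℕ-rank : ∀ p → toℕ (rank p) ≡ ∣ p ∣
    toℕ-rank p = toℕ-fromℕ< (s≤s (∣p∣≤n p))

    L? : ∀ u → Decidable (λ w → L w ≤ᴿ L u)
    L? u w = proj₁ (dec w u)

    R? : ∀ u → Decidable (λ w → L w ≤ᴿ R u)
    R? u w = proj₂ (dec w u)

    below-L below-R : Fin n → Subset n
    below-L u = ⟦ L? u ⟧
    below-R u = ⟦ R? u ⟧

-- Interval models with natural endpoints and their decidability

Overlap : (L R : Fin d → Fin n → ℕ) → Fin n → Fin n → Set
Overlap L R u v = ∀ i → L i u ≤ R i v × L i v ≤ R i u

-- The diagonal is left out because a box always meets itself, whereas adjacency is irreflexive.
record IsIntervalModel (E : Fin n → Fin n → Set ℓ) (L R : Fin d → Fin n → ℕ) : Set ℓ where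
  field
    L≤R         : ∀ i u → L i u ≤ R i u
    adj⇔overlap : ∀ u v → u ≢ v → E u v ⇔ Overlap L R u v

open IsIntervalModel

IsIntervalModel? : {E : Fin n → Fin n → Set ℓ} → Decidable₂ E →
                   (L R : Fin d → Fin n → ℕ) → Dec (IsIntervalModel E L R)
IsIntervalModel? E? L R = map′
  (λ (p , q) → record { L≤R = p ; adj⇔overlap = λ u v u≢v → mk⇔ (proj₁ (q u v u≢v)) (proj₂ (q u v u≢v)) })
  (λ m → L≤R m , λ u v u≢v → to (adj⇔overlap m u v u≢v) , from (adj⇔overlap m u v u≢v))
  ((all? λ i → all? λ u → L i u ≤? R i u)
   ×-dec
   (all? λ u → all? λ v → ¬? (u Fin.≟ v) →-dec
     ((E? u v →-dec O? u v) ×-dec (O? u v →-dec E? u v))))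
  where
  O? : ∀ u v → Dec (Overlap L R u v)
  O? u v = all? λ i → (L i u ≤? R i v) ×-dec (L i v ≤? R i u)

-- Coding a function by a number and decoding it returns the function only up to pointwise equality,
-- so models have to be transported along it.
IsIntervalModel-resp : {E : Fin n → Fin n → Set ℓ} {L R L′ R′ : Fin d → Fin n → ℕ} →
  (∀ i u → L i u ≡ L′ i u) → (∀ i u → R i u ≡ R′ i u) →
  IsIntervalModel E L R → IsIntervalModel E L′ R′
IsIntervalModel-resp L≡ R≡ m = record
  { L≤R = λ i u → subst₂ _≤_ (L≡ i u) (R≡ i u) (L≤R m i u)
  ; adj⇔overlap = λ u v u≢v → mk⇔
      (λ e i → let p , q = to (adj⇔overlap m u v u≢v) e i in
        subst₂ _≤_ (L≡ i u) (R≡ i v) p , subst₂ _≤_ (L≡ i v) (R≡ i u) q)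
      (λ o → from (adj⇔overlap m u v u≢v) λ i → let p , q = o i in
        subst₂ _≤_ (sym (L≡ i u)) (sym (R≡ i v)) p ,
        subst₂ _≤_ (sym (L≡ i v)) (sym (R≡ i u)) q)
  }

-- Numbering the endpoint functions turns the search for a model into a search over a finite `Fin`.
decode : ∀ {k} → Fin ((k ^ n) ^ d) → Fin d → Fin n → Fin k
decode c i u = finToFun (finToFun c i) u

encode : ∀ {k} → (Fin d → Fin n → Fin k) → Fin ((k ^ n) ^ d)
encode f = funToFin (λ i → funToFin (f i))

decode-encode : ∀ {k} (f : Fin d → Fin n → Fin k) i u → f i u ≡ decode (encode f) i u
decode-encode f i u = sym (trans
  (cong (λ c → finToFun c u) (finToFun-funToFin (λ i → funToFin (f i)) i))
  (finToFun-funToFin (f i) u))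

-- The values `0` to `n` suffice, since `discretise` uses sizes of subsets of an `n`-element set.
HasGridModel : ℕ → (Fin n → Fin n → Set ℓ) → Set ℓ
HasGridModel {n} d E = Σ (Fin d → Fin n → Fin (suc n)) λ L → Σ (Fin d → Fin n → Fin (suc n)) λ R →
  IsIntervalModel E (λ i → toℕ ∘ L i) (λ i → toℕ ∘ R i)

HasGridModel? : {E : Fin n → Fin n → Set ℓ} → Decidable₂ E → ∀ d → Dec (HasGridModel d E)
HasGridModel? E? d = map′
  (λ (cL , cR , m) → decode cL , decode cR , m)
  (λ (L , R , m) → encode L , encode R , IsIntervalModel-resp
    (λ i u → cong toℕ (decode-encode L i u)) (λ i u → cong toℕ (decode-encode R i u)) m)
  (any? λ cL → any? λ cR → IsIntervalModel? E? _ _)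

-- Box representations of an enumerated graph

module _ (G : Graph a b ℓ) (enum : Inverse (Graph.vertices G) (setoid (Fin n)))
         (Adj? : Decidable₂ (Graph.Adj G)) where
  open Graph G
  open Inverse enum using (strictlyInverseˡ; strictlyInverseʳ)
    renaming (to to index; from to vertex; to-cong to index-cong)

  IndexAdj : Fin n → Fin n → Set ℓ
  IndexAdj u v = Adj (vertex u) (vertex v)

  IndexAdj? : Decidable₂ IndexAdj
  IndexAdj? u v = Adj? (vertex u) (vertex v)

  intervalModel⇒boxRepresentable : {L R : Fin d → Fin n → ℕ} →
    IsIntervalModel IndexAdj L R → BoxRepresentable G d
  intervalModel⇒boxRepresentable {d} {L} {R} m = Fin n , box , record
    { bijection = enum
    ; preserves = λ x y → mk⇔
        (λ xy → index≢ xy , meet (to (adj⇔overlap m _ _ (index≢ xy)) (adj⁺ xy)))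
        (λ (x≢y , z , x∋z , y∋z) → adj⁻ (from (adj⇔overlap m _ _ x≢y) λ i →
          common (index x) (index y) z i (x∋z i) (y∋z i) ,
          common (index y) (index x) z i (y∋z i) (x∋z i)))
    }
    where
    box : Fin n → Box d
    box u i = record { left = fromℕᴿ (L i u) ; right = fromℕᴿ (R i u)
                     ; left≤right = fromℕᴿ-mono (L≤R m i u) }

    common : ∀ u v (z : Fin d → ℝ) i → z i ∈ᴵ box u i → z i ∈ᴵ box v i → L i u ≤ R i v
    common u v z i (Lu≤z , _) (_ , z≤Rv) = fromℕᴿ-reflects (L i u) (R i v)
      (≤ᴿ-trans (fromℕᴿ (L i u)) (z i) (fromℕᴿ (R i v)) Lu≤z z≤Rv)

    adj⁺ : ∀ {x y} → Adj x y → IndexAdj (index x) (index y)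
    adj⁺ {x} {y} xy = proj₁ Adj-resp (V.sym (strictlyInverseʳ y))
      (proj₂ Adj-resp (V.sym (strictlyInverseʳ x)) xy)
      where module V = Setoid vertices

    adj⁻ : ∀ {x y} → IndexAdj (index x) (index y) → Adj x y
    adj⁻ {x} {y} xy = proj₁ Adj-resp (strictlyInverseʳ y)
      (proj₂ Adj-resp (strictlyInverseʳ x) xy)

    index≢ : ∀ {x y} → Adj x y → index x ≢ index y
    index≢ {x} {y} xy x≡y = Adj-irrefl
      (V.trans (V.sym (strictlyInverseʳ x))
        (V.trans (V.reflexive (cong vertex x≡y)) (strictlyInverseʳ y))) xy
      where module V = Setoid vertices

    meet : ∀ {u v} → Overlap L R u v → Intersect (box u) (box v)
    meet {u} {v} o = (λ i → fromℕᴿ (L i u ⊔ L i v)) ,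
      (λ i → fromℕᴿ-mono (m≤m⊔n _ _) , fromℕᴿ-mono (⊔-lub (L≤R m i u) (proj₂ (o i)))) ,
      (λ i → fromℕᴿ-mono (m≤n⊔m _ _) , fromℕᴿ-mono (⊔-lub (proj₁ (o i)) (L≤R m i v)))

  -- The double negation comes from comparing real endpoints. It is harmless, because the existence
  -- of a grid model is decidable.
  boxRepresentable⇒gridModel : BoxRepresentable G d → ¬ ¬ HasGridModel d IndexAdj
  boxRepresentable⇒gridModel {d} (I , B , iso) = ¬¬-map build (¬¬-choice λ i → discretise (L i) (R i))
    where
    open _≅_ iso
    open Inverse bijection using () renaming
      (to to name; strictlyInverseʳ to name⁻¹∘name; from-cong to name⁻¹-cong)
    module V = Setoid vertices

    box : Fin n → Box d
    box u = B (name (vertex u))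

    L R : Fin d → Fin n → ℝ
    L i u = Interval.left (box u i)
    R i u = Interval.right (box u i)

    name≢ : ∀ {u v} → u ≢ v → name (vertex u) ≢ name (vertex v)
    name≢ {u} {v} u≢v nu≡nv = u≢v (trans (sym (strictlyInverseˡ u))
      (trans (index-cong (V.trans (V.sym (name⁻¹∘name _))
        (V.trans (name⁻¹-cong nu≡nv) (name⁻¹∘name _)))) (strictlyInverseˡ v)))

    -- In each coordinate the larger of the two left endpoints lies in both intervals; which one is
    -- larger is known only under double negation.
    meet : ∀ {u v} → (∀ i → L i u ≤ᴿ R i v × L i v ≤ᴿ R i u) → ¬ ¬ Intersect (box u) (box v)
    meet {u} {v} o = ¬¬-map
      (λ z → (λ i → proj₁ (z i)) , (λ i → proj₁ (proj₂ (z i))) , (λ i → proj₂ (proj₂ (z i))))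
      (¬¬-choice λ i → ¬¬-map (point i) ¬¬-excluded-middle)
      where
      point : ∀ i → Dec (L i u ≤ᴿ L i v) → ∃[ z ] (z ∈ᴵ box u i × z ∈ᴵ box v i)
      point i (yes u≤v) = L i v , (u≤v , proj₂ (o i)) ,
                          (≤ᴿ-refl (L i v) , Interval.left≤right (box v i))
      point i (no  u≰v) = L i u , (≤ᴿ-refl (L i u) , Interval.left≤right (box u i)) ,
                          (≰ᴿ⇒≥ᴿ (L i u) (L i v) u≰v , proj₁ (o i))

    build : (∀ i → Discretisation (L i) (R i)) → HasGridModel d IndexAdj
    build grid = (λ i → proj₁ (grid i)) , (λ i → proj₁ (proj₂ (grid i))) , record
      { L≤R = λ i u → to (order i u u) (Interval.left≤right (box u i))
      ; adj⇔overlap = λ u v u≢v → mk⇔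
          (λ uv → let _ , z , u∋z , v∋z = to (preserves _ _) uv in λ i →
            to (order i u v) (≤ᴿ-trans (L i u) (z i) (R i v) (proj₁ (u∋z i)) (proj₂ (v∋z i))) ,
            to (order i v u) (≤ᴿ-trans (L i v) (z i) (R i u) (proj₁ (v∋z i)) (proj₂ (u∋z i))))
          -- Adjacency is decidable, so a common point under double negation is enough.
          (λ o → decidable-stable (IndexAdj? u v) (¬¬-map
            (λ ∩ → from (preserves _ _) (name≢ u≢v , ∩))
            (meet λ i → from (order i u v) (proj₁ (o i)) , from (order i v u) (proj₂ (o i)))))
      }
      where
      order : ∀ i u v → L i u ≤ᴿ R i v ⇔ toℕ (proj₁ (grid i) u) ≤ toℕ (proj₁ (proj₂ (grid i)) v)
      order i = proj₂ (proj₂ (grid i))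

  BoxRepresentable? : ∀ d → Dec (BoxRepresentable G d)
  BoxRepresentable? d = map′
    (λ (_ , _ , m) → intervalModel⇒boxRepresentable m)
    (λ r → decidable-stable (HasGridModel? IndexAdj? d) (boxRepresentable⇒gridModel r))
    (HasGridModel? IndexAdj? d)

  boxicity-≤ : ∀ {k} → 1 ≤ k → BoxRepresentable G k → ∃[ d ] (IsBoxicity G d × d ≤ k)
  boxicity-≤ {k} 1≤k r with least (λ d → (1 ≤? d) ×-dec BoxRepresentable? d) k (1≤k , r)
  ... | d , (1≤d , rep) , d≤k , min = d , record
    { positive = 1≤d
    ; representable = rep
    ; least = λ d′ 1≤d′ r′ → min d′ (1≤d′ , r′)
    } , d≤k

-- Divisors whose square is not a multiple of the number

Factors : Set
Factors = List (ℕ × ℕ)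

value : Factors → ℕ
value = product ∘ map (λ (p , k) → p ^ k)

divisors : Factors → List ℕ
divisors []            = 1 ∷ []
divisors ((p , k) ∷ s) = cartesianProductWith (λ e d → p ^ e * d) (upTo (suc k)) (divisors s)

-- For e < ⌈k/2⌉ the factor p^k already fails to divide the square of p^e d; for
-- larger e the remaining factors have to fail to divide d².
nonAnnihilators : Factors → List ℕ
nonAnnihilators []            = []
nonAnnihilators ((p , k) ∷ s) =
  cartesianProductWith (λ e d → p ^ e * d) (upTo ⌈ k /2⌉) (divisors s) ++
  cartesianProductWith (λ e d → p ^ e * d) (applyUpTo (_+_ ⌈ k /2⌉) (suc ⌊ k /2⌋)) (nonAnnihilators s)

-- The exponents `e` with `k ≤ 2e` and `e ≤ k` run from `⌈ k /2⌉` to `k`, which gives `suc ⌊ k /2⌋`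
-- choices.
#divisors #annihilators : Factors → ℕ
#divisors     = product ∘ map (λ (_ , k) → suc k)
#annihilators = product ∘ map (λ (_ , k) → suc ⌊ k /2⌋)

length-cartesianProductWith : ∀ {A B C : Set} (f : A → B → C) xs ys →
  length (cartesianProductWith f xs ys) ≡ length xs * length ys
length-cartesianProductWith f []       ys = refl
length-cartesianProductWith f (x ∷ xs) ys = trans (length-++ (map (f x) ys))
  (cong₂ _+_ (length-map (f x) ys) (length-cartesianProductWith f xs ys))

length-divisors : ∀ s → length (divisors s) ≡ #divisors s
length-divisors []            = refl
length-divisors ((p , k) ∷ s) = trans
  (length-cartesianProductWith _ (upTo (suc k)) (divisors s))
  (cong₂ _*_ (length-upTo (suc k)) (length-divisors s))

-- By induction: the `h` small exponents pair with all `D` divisors of the rest, the `l` large ones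
-- with the `G` non-annihilators of the rest. Then `G + M = D` and `h + l = k + 1` give the total.
length-nonAnnihilators : ∀ s → length (nonAnnihilators s) + #annihilators s ≡ #divisors s
length-nonAnnihilators []            = refl
length-nonAnnihilators ((p , k) ∷ s) = begin
  length (nonAnnihilators ((p , k) ∷ s)) + l * M
    ≡⟨ cong (_+ l * M) (trans (length-++ (cartesianProductWith _ (upTo h) (divisors s)))
      (cong₂ _+_
        (trans (length-cartesianProductWith _ (upTo h) (divisors s))
          (cong₂ _*_ (length-upTo h) (length-divisors s)))
        (trans (length-cartesianProductWith _ (applyUpTo (_+_ h) l) (nonAnnihilators s))
          (cong (_* G) (length-applyUpTo (_+_ h) l))))) ⟩
  h * D + l * G + l * M   ≡⟨ +-assoc (h * D) _ _ ⟩
  h * D + (l * G + l * M) ≡⟨ cong (_+_ (h * D)) (*-distribˡ-+ l G M) ⟨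
  h * D + l * (G + M)     ≡⟨ cong (λ x → h * D + l * x) (length-nonAnnihilators s) ⟩
  h * D + l * D           ≡⟨ *-distribʳ-+ D h l ⟨
  (h + l) * D             ≡⟨ cong (_* D) (trans (+-suc h _) (cong suc
                               (trans (+-comm h _) (⌊n/2⌋+⌈n/2⌉≡n k)))) ⟩
  suc k * D               ∎
  where
  open ≡-Reasoning
  h l D G M : ℕ
  h = ⌈ k /2⌉
  l = suc ⌊ k /2⌋
  D = #divisors s
  G = length (nonAnnihilators s)
  M = #annihilators s

prime∤⇒coprime : ∀ {p d} → Prime p → p ∤ d → Coprime d p
prime∤⇒coprime pp p∤d (c∣d , c∣p) with prime⇒irreducible pp c∣p
... | inj₁ c≡1  = c≡1
... | inj₂ refl = contradiction c∣d p∤d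

-- Factors `p` are stripped off one at a time: if `p` divides `d`, it cancels on both sides;
-- otherwise `d` is coprime to `p` and divides what remains without that factor.
∣p^k*m⇒split : ∀ {p d m} → Prime p → ∀ k → d ∣ p ^ k * m →
               ∃[ e ] ∃[ d′ ] (e ≤ k × d′ ∣ m × d ≡ p ^ e * d′)
∣p^k*m⇒split {d = d} {m} pp zero d∣ =
  0 , d , z≤n , subst (d ∣_) (*-identityˡ m) d∣ , sym (*-identityˡ d)
∣p^k*m⇒split {p} {d} {m} pp (suc k) d∣ with p ∣? d
... | no p∤d =
  let e , d′ , e≤k , d′∣m , eq = ∣p^k*m⇒split pp k
        (coprime-divisor (prime∤⇒coprime pp p∤d) (subst (d ∣_) (*-assoc p (p ^ k) m) d∣))
  in e , d′ , m≤n⇒m≤1+n e≤k , d′∣m , eq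
... | yes (divides c refl) =
  let instance _ = prime⇒nonZero pp
      e , d′ , e≤k , d′∣m , eq = ∣p^k*m⇒split pp k
        (*-cancelˡ-∣ p (subst₂ _∣_ (*-comm c p) (*-assoc p (p ^ k) m) d∣))
  in suc e , d′ , s≤s e≤k , d′∣m ,
     trans (*-comm c p) (trans (cong (p *_) eq) (sym (*-assoc p (p ^ e) d′)))

PrimeBases : Factors → Set
PrimeBases = All (Prime ∘ proj₁)

∈-divisors : ∀ {s} → PrimeBases s → ∀ {d} → d ∣ value s → d ∈ divisors s
∈-divisors [] d∣1 = here (∣1⇒≡1 d∣1)
∈-divisors {(p , k) ∷ s} (pp ∷ ps) d∣ with ∣p^k*m⇒split pp k d∣
... | e , d′ , e≤k , d′∣m , refl =
  ∈-cartesianProductWith⁺ (λ e d → p ^ e * d) (∈-upTo⁺ (s≤s e≤k)) (∈-divisors ps d′∣m)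

∈-nonAnnihilators : ∀ {s} → PrimeBases s → ∀ {d} → d ∣ value s → value s ∤ d * d →
                    d ∈ nonAnnihilators s
∈-nonAnnihilators [] d∣1 1∤ = contradiction (1∣ _) 1∤
∈-nonAnnihilators {(p , k) ∷ s} (pp ∷ ps) d∣ ∤dd with ∣p^k*m⇒split pp k d∣
... | e , d′ , e≤k , d′∣m , refl with e <? ⌈ k /2⌉
... | yes e<h = ∈-++⁺ˡ
  (∈-cartesianProductWith⁺ (λ e d → p ^ e * d) (∈-upTo⁺ e<h) (∈-divisors ps d′∣m))
... | no e≮h = ∈-++⁺ʳ (cartesianProductWith (λ e d → p ^ e * d) (upTo ⌈ k /2⌉) (divisors s))
  (∈-cartesianProductWith⁺ (λ e d → p ^ e * d)
    (subst (_∈ applyUpTo (_+_ ⌈ k /2⌉) (suc ⌊ k /2⌋)) (m+[n∸m]≡n h≤e)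
      (∈-applyUpTo⁺ (_+_ ⌈ k /2⌉) (s≤s e∸h≤l)))
    -- Here `k ≤ 2e`, so `p ^ k` divides the square of `p ^ e`. Were the square of `d′` a multiple
    -- of the remaining value, the square of the whole divisor would be a multiple of the whole
    -- value.
    (∈-nonAnnihilators ps d′∣m λ ∣d′d′ → ∤dd (subst (value ((p , k) ∷ s) ∣_) regroup
      (*-pres-∣ (m≤n⇒p^m∣p^n k≤2e) ∣d′d′))))
  where
  h≤e : ⌈ k /2⌉ ≤ e
  h≤e = ≮⇒≥ e≮h

  e∸h≤l : e ∸ ⌈ k /2⌉ ≤ ⌊ k /2⌋
  e∸h≤l = m≤n+o⇒m∸n≤o e ⌈ k /2⌉ (≤-trans e≤k
    (≤-reflexive (sym (trans (+-comm ⌈ k /2⌉ _) (⌊n/2⌋+⌈n/2⌉≡n k)))))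

  k≤2e : k ≤ e + e
  k≤2e = ≤-trans (≤-reflexive (sym (⌊n/2⌋+⌈n/2⌉≡n k)))
    (+-mono-≤ (≤-trans (⌊n/2⌋≤⌈n/2⌉ k) h≤e) h≤e)

  m≤n⇒p^m∣p^n : ∀ {m n} → m ≤ n → p ^ m ∣ p ^ n
  m≤n⇒p^m∣p^n {m} {n} m≤n = subst (λ x → p ^ m ∣ p ^ x) (m+[n∸m]≡n m≤n)
    (subst (p ^ m ∣_) (sym (^-distribˡ-+-* p m (n ∸ m))) (m∣m*n (p ^ (n ∸ m))))

  regroup : p ^ (e + e) * (d′ * d′) ≡ p ^ e * d′ * (p ^ e * d′)
  regroup = trans (cong (_* (d′ * d′)) (^-distribˡ-+-* p e e))
    ([m*n]*[o*p]≡[m*o]*[n*p] (p ^ e) (p ^ e) d′ d′)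

-- The interval graph of a class

-- If m = m′ g and n = n′ g with m′, n′ coprime, then m² n′ = m′ (m n) and
-- n² m′ = n′ (m n).
∣m²∣n²⇒∣mn : ∀ {N} m n .{{_ : NonZero m}} → N ∣ m * m → N ∣ n * n → N ∣ m * n
∣m²∣n²⇒∣mn {N} m n ∣mm ∣nn with gcd m n | gcd[m,n]∣m m n | gcd[m,n]∣n m n | gcd-GCD m n
... | g | divides m′ refl | divides n′ refl | isGCD = coprime-factors {m = m′} {n = n′} coprime
  ( subst (N ∣_) (lemˡ m′ n′ g) (∣m⇒∣m*n n′ ∣mm)
  , subst (N ∣_) (lemʳ m′ n′ g) (∣m⇒∣m*n m′ ∣nn))
  where
  instance
    g≢0 : NonZero g
    g≢0 = m*n≢0⇒n≢0 m′

  coprime : Coprime m′ n′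
  coprime {c} (c∣m′ , c∣n′) = ∣1⇒≡1 (*-cancelʳ-∣ g (subst (c * g ∣_) (sym (*-identityˡ g))
    (GCD.greatest isGCD (*-monoˡ-∣ g c∣m′ , *-monoˡ-∣ g c∣n′))))

  lemˡ : ∀ x y g → x * g * (x * g) * y ≡ x * (x * g * (y * g))
  lemˡ = ℕ.solve-∀

  lemʳ : ∀ x y g → y * g * (y * g) * x ≡ y * (x * g * (y * g))
  lemʳ = ℕ.solve-∀

module _ (N : ℕ) where
  -- `N` divides both `m * n` and `N * n`, hence their gcd, which is `gcd m N * n`.
  ∣mn⇒∣gcd*n : ∀ m n → N ∣ m * n → N ∣ gcd m N * n
  ∣mn⇒∣gcd*n m n ∣mn = subst (N ∣_)
    (trans (sym (c*gcd[m,n]≡gcd[cm,cn] n m N)) (*-comm n _))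
    (gcd-greatest (subst (N ∣_) (*-comm m n) ∣mn) (n∣m*n n))

  ∣gcd*n⇒∣mn : ∀ m n → N ∣ gcd m N * n → N ∣ m * n
  ∣gcd*n⇒∣mn m n ∣gn = ∣-trans ∣gn (*-monoˡ-∣ n (gcd[m,n]∣m m N))

  -- The shift to `suc x` keeps the class clear of the point `0`, where every other interval begins.
  -- The right end `N` of a joined interval reaches all class points because representatives are
  -- below `N`.
  data Placement (d x : ℕ) : ℕ → ℕ → Set where
    inClass : gcd x N ≡ d → Placement d x (suc x) (suc x)
    joined  : gcd x N ≢ d → N ∣ d * x → Placement d x 0 N
    apart   : gcd x N ≢ d → N ∤ d * x → Placement d x 0 0

  place : ∀ d x → ∃[ l ] ∃[ r ] Placement d x l r
  place d x with gcd x N ≟ d | N ∣? d * x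
  ... | yes p | _     = suc x , suc x , inClass p
  ... | no ¬p | yes q = 0 , N , joined ¬p q
  ... | no ¬p | no ¬q = 0 , 0 , apart ¬p ¬q

  private variable x y lx rx ly ry : ℕ

  placement-≤ : Placement d x lx rx → lx ≤ rx
  placement-≤ (inClass _)  = ≤-refl
  placement-≤ (joined _ _) = z≤n
  placement-≤ (apart _ _)  = z≤n

  -- Two members of the class cannot be adjacent, since replacing both factors by their gcd with `N`
  -- gives `N ∣ d * d`. Nor can a member be adjacent to an element placed apart. The other
  -- inequality of an overlap follows by exchanging `x` and `y`.
  placement-overlap : N ∤ d * d → x < N → N ∣ x * y →
    Placement d x lx rx → Placement d y ly ry → lx ≤ ry
  placement-overlap {x = x} {y = y} ∤dd x<N ∣xy (inClass refl) (inClass gy≡d) =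
    contradiction
      (subst (λ z → N ∣ z * gcd x N) gy≡d (∣mn⇒∣gcd*n y (gcd x N)
        (subst (N ∣_) (*-comm (gcd x N) y) (∣mn⇒∣gcd*n x y ∣xy))))
      ∤dd
  placement-overlap ∤dd x<N ∣xy (inClass _) (joined _ _) = x<N
  placement-overlap {x = x} {y = y} ∤dd x<N ∣xy (inClass refl) (apart _ ∤dy) =
    contradiction (∣mn⇒∣gcd*n x y ∣xy) ∤dy
  placement-overlap ∤dd x<N ∣xy (joined _ _) _ = z≤n
  placement-overlap ∤dd x<N ∣xy (apart _ _)  _ = z≤n

  -- A joined `y` would give `N ∣ x * y`, and a `y` placed apart would need `suc x ≤ 0`, so that
  -- case does not arise. Only equal points of the class remain.
  placement-separates : gcd x N ≡ d → N ∤ x * y →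
    Placement d x lx rx → Placement d y ly ry → lx ≤ ry → ly ≤ rx → x ≡ y
  placement-separates _ _ (inClass _) (inClass _) (s≤s x≤y) (s≤s y≤x) = ≤-antisym x≤y y≤x
  placement-separates {x = x} {y = y} _ ∤xy (inClass refl) (joined _ ∣dy) _ _ =
    contradiction (∣gcd*n⇒∣mn x y ∣dy) ∤xy
  placement-separates gx≡d _ (joined gx≢d _) _ _ _ = contradiction gx≡d gx≢d
  placement-separates gx≡d _ (apart gx≢d _)  _ _ _ = contradiction gx≡d gx≢d

-- Enumeration of the vertices

lookup-injective : ∀ {A : Set} {xs : List A} → Unique xs →
                   ∀ {i j} → lookup xs i ≡ lookup xs j → i ≡ j
lookup-injective (x∉ ∷ _) {zero}  {zero}  _  = refl
lookup-injective (x∉ ∷ _) {zero}  {suc j} eq = contradiction eq (All.lookup x∉ (∈-lookup j))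
lookup-injective (x∉ ∷ _) {suc i} {zero}  eq = contradiction (sym eq) (All.lookup x∉ (∈-lookup i))
lookup-injective (_ ∷ u)  {suc i} {suc j} eq = cong suc (lookup-injective u eq)

module ZeroDivisors (N : ℕ) .{{_ : NonZero N}} where
  private module R = CommutativeRing (ℤ/ N)
  open R using (_≈_)

  Γ : Graph _ _ _
  Γ = zeroDivisorGraph (ℤ/ N)

  open Graph Γ using (Vertex; Adj; vertices)

  ≈-sym : ∀ i j → i ≈ j → j ≈ i
  ≈-sym i j = R.sym {i} {j}

  ≈-trans : ∀ i j k → i ≈ j → j ≈ k → i ≈ k
  ≈-trans i j k = R.trans {i} {j} {k}

  ≡0⇔∣ : ∀ i → (i ≈ 0ℤ) ⇔ N ∣ ℤ.∣ i ∣
  ≡0⇔∣ i = mk⇔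
    (λ i≡0 → ℤ.∣⇒∣ᵤ (subst (+ N ℤ.∣_) (ℤ.+-identityʳ i) i≡0))
    (λ N∣i → subst (+ N ℤ.∣_) (sym (ℤ.+-identityʳ i)) (ℤ.∣ᵤ⇒∣ N∣i))

  *≡0⇔∣ : ∀ x y → (+ x ℤ.* + y ≈ 0ℤ) ⇔ N ∣ x * y
  *≡0⇔∣ x y = subst (λ k → (+ x ℤ.* + y ≈ 0ℤ) ⇔ N ∣ k) (ℤ.abs-* (+ x) (+ y)) (≡0⇔∣ (+ x ℤ.* + y))

  -- If `y < x`, then `N` would divide the positive number `x ∸ y`, which is less than `N`.
  ≡ᴺ⇒≤ : ∀ {x y} → x < N → + x ≈ + y → x ≤ y
  ≡ᴺ⇒≤ {x} {y} x<N x≡y = ≮⇒≥ λ y<x →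
    let instance _ = >-nonZero (m<n⇒0<n∸m y<x) in
    >⇒∤ (≤-<-trans (m∸n≤m x y) x<N) (subst (N ∣_)
      (trans (cong ℤ.∣_∣ (ℤ.m-n≡m⊖n x y)) (trans (ℤ.∣m⊖n∣≡∣n⊖m∣ x y) (ℤ.∣⊖∣-≤ (<⇒≤ y<x))))
      (ℤ.∣⇒∣ᵤ x≡y))

  ≡ᴺ⇒≡ : ∀ {x y} → x < N → y < N → + x ≈ + y → x ≡ y
  ≡ᴺ⇒≡ {x} {y} x<N y<N x≡y =
    ≤-antisym (≡ᴺ⇒≤ x<N x≡y) (≡ᴺ⇒≤ y<N (≈-sym (+ x) (+ y) x≡y))

  residue : ℤ → ℕ
  residue i = i %ℕ N

  residue-< : ∀ i → residue i < N
  residue-< i = n%ℕd<d i N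

  residue-≡ : ∀ i → i ≈ + residue i
  residue-≡ i = ℤ.divides (i /ℕ N) (trans
    (cong (ℤ._- + residue i) (a≡a%ℕn+[a/ℕn]*n i N))
    (cancel (+ residue i) (i /ℕ N ℤ.* + N)))
    where
    cancel : ∀ r q → (r ℤ.+ q) ℤ.- r ≡ q
    cancel = solve-∀

  residue-cong : ∀ {i j} → i ≈ j → residue i ≡ residue j
  residue-cong {i} {j} i≡j = ≡ᴺ⇒≡ (residue-< i) (residue-< j)
    (≈-trans (+ residue i) i (+ residue j) (≈-sym i (+ residue i) (residue-≡ i))
      (≈-trans i j (+ residue j) i≡j (residue-≡ j)))

  -- A decidable criterion for a residue below `N` to be a nonzero zero-divisor.
  IsVertex : ℕ → Set
  IsVertex x = x ≢ 0 × gcd x N ≢ 1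

  IsVertex? : Decidable IsVertex
  IsVertex? x = ¬? (x ≟ 0) ×-dec ¬? (gcd x N ≟ 1)

  representatives : List ℕ
  representatives = filter IsVertex? (upTo N)

  representatives-unique : Unique representatives
  representatives-unique = Unique.filter⁺ IsVertex? (Unique.upTo⁺ N)

  rep : Fin (length representatives) → ℕ
  rep = lookup representatives

  rep-< : ∀ u → rep u < N
  rep-< u = ∈-upTo⁻ (proj₁ (∈-filter⁻ IsVertex? {xs = upTo N} (∈-lookup u)))

  rep-isVertex : ∀ u → IsVertex (rep u)
  rep-isVertex u = proj₂ (∈-filter⁻ IsVertex? {xs = upTo N} (∈-lookup u))

  -- If the residue were coprime to `N`, it could be cancelled from `N ∣ residue i * ∣ j ∣`, making
  -- the annihilating `j` zero.
  residue-isVertex : ∀ i → ¬ i ≈ 0ℤ → IsZeroDivisor (ℤ/ N) i → IsVertex (residue i)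
  residue-isVertex i i≢0 (j , j≢0 , ij≡0) =
    (λ ri≡0 → i≢0 (subst (i ≈_) (cong +_ ri≡0) (residue-≡ i))) ,
    (λ gcd≡1 → j≢0 (from (≡0⇔∣ j)
      (coprime-divisor {n = residue i} (coprime-sym (gcd≡1⇒coprime gcd≡1)) ∣rj)))
    where
    ∣rj : N ∣ residue i * ℤ.∣ j ∣
    ∣rj = subst (N ∣_) (ℤ.abs-* (+ residue i) j) (to (≡0⇔∣ (+ residue i ℤ.* j))
      (≈-trans (+ residue i ℤ.* j) (i ℤ.* j) 0ℤ
        (R.*-congʳ {j} {+ residue i} {i} (≈-sym i (+ residue i) (residue-≡ i))) ij≡0))

  isVertex⇒nonZero : ∀ {x} → x < N → IsVertex x → ¬ + x ≈ 0ℤ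
  isVertex⇒nonZero x<N (x≢0 , _) x≡0 =
    x≢0 (≡ᴺ⇒≡ x<N (>-nonZero⁻¹ N) x≡0)

  isVertex⇒zeroDivisor : ∀ {x} → x < N → IsVertex x → IsZeroDivisor (ℤ/ N) (+ x)
  isVertex⇒zeroDivisor {x} x<N (_ , g≢1) with gcd[m,n]∣m x N | gcd[m,n]∣n x N
  ... | divides c x≡cg | divides z N≡zg =
    -- The annihilator is `z = N / gcd x N`; it is nonzero modulo `N` because the gcd exceeds 1, so
    -- that `0 < z < N`.
    + z , z≢0 , from (*≡0⇔∣ x z) (divides c x*z≡c*N)
    where
    open ≡-Reasoning
    g : ℕ
    g = gcd x N

    instance
      zg≢0 : NonZero (z * g)
      zg≢0 = subst NonZero N≡zg (>-nonZero (>-nonZero⁻¹ N))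
      nz : NonZero z
      nz = m*n≢0⇒m≢0 z {g}
      ng : NonTrivial g
      ng = n>1⇒nonTrivial (≤∧≢⇒< (>-nonZero⁻¹ g {{m*n≢0⇒n≢0 z}}) (g≢1 ∘ sym))

    z<N : z < N
    z<N = subst (z <_) (sym N≡zg) (m<m*n z g (nonTrivial⇒n>1 g))

    z≢0 : ¬ + z ≈ 0ℤ
    z≢0 z≡0 = ≢-nonZero⁻¹ z (≡ᴺ⇒≡ z<N (>-nonZero⁻¹ N) z≡0)

    x*z≡c*N : x * z ≡ c * N
    x*z≡c*N = begin
      x * z       ≡⟨ cong (_* z) x≡cg ⟩
      c * g * z   ≡⟨ *-assoc c g z ⟩
      c * (g * z) ≡⟨ cong (c *_) (*-comm g z) ⟩
      c * (z * g) ≡⟨ cong (c *_) N≡zg ⟨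
      c * N       ∎

  vertex : Fin (length representatives) → Vertex
  vertex u = + rep u , isVertex⇒nonZero (rep-< u) (rep-isVertex u)
                     , isVertex⇒zeroDivisor (rep-< u) (rep-isVertex u)

  member : (v : Vertex) → residue (proj₁ v) ∈ representatives
  member (i , i≢0 , zd) = ∈-filter⁺ IsVertex? (∈-upTo⁺ (residue-< i)) (residue-isVertex i i≢0 zd)

  rep-index : (v : Vertex) → rep (Any.index (member v)) ≡ residue (proj₁ v)
  rep-index v = sym (lookup-index (member v))

  enumeration : Inverse vertices (setoid (Fin (length representatives)))
  enumeration = record
    { to        = λ v → Any.index (member v)
    ; from      = vertex
    ; to-cong   = λ {v} {w} v≈w → lookup-injective representatives-unique
        (trans (rep-index v) (trans (residue-cong {proj₁ v} {proj₁ w} v≈w) (sym (rep-index w))))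
    ; from-cong = λ {u} u≡v → R.reflexive {+ rep u} (cong (+_ ∘ rep) u≡v)
    ; inverse   =
        (λ {u} {v} v≈u → lookup-injective representatives-unique
          (trans (rep-index v) (≡ᴺ⇒≡ (residue-< (proj₁ v)) (rep-< u)
            (≈-trans (+ residue (proj₁ v)) (proj₁ v) (+ rep u)
              (≈-sym (proj₁ v) (+ residue (proj₁ v)) (residue-≡ (proj₁ v))) v≈u)))) ,
        (λ {v} {u} u≡ → subst (λ x → + x ≈ proj₁ v) (sym (trans (cong rep u≡) (rep-index v)))
          (≈-sym (proj₁ v) (+ residue (proj₁ v)) (residue-≡ (proj₁ v))))
    }

  Adj? : ∀ v w → Dec (Adj v w)
  Adj? (i , _) (j , _) = ¬? (+ N ℤ.∣? (i ℤ.- j)) ×-dec (+ N ℤ.∣? (i ℤ.* j ℤ.- 0ℤ))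

  -- The interval model given by a list of classes

  module _ (ds : List ℕ) (∤squares : ∀ {d} → d ∈ ds → N ∤ d * d)
           (covers : ∀ {d} → d ∣ N → d ≢ 1 → N ∤ d * d → d ∈ ds) where

    L R′ : Fin (length ds) → Fin (length representatives) → ℕ
    L  i u = proj₁ (place N (lookup ds i) (rep u))
    R′ i u = proj₁ (proj₂ (place N (lookup ds i) (rep u)))

    placed : ∀ i u → Placement N (lookup ds i) (rep u) (L i u) (R′ i u)
    placed i u = proj₂ (proj₂ (place N (lookup ds i) (rep u)))

    -- The gcd of `rep u` with `N` is not 1, so `covers` provides a coordinate for the class of `u`;
    -- in that coordinate distinct non-adjacent vertices have disjoint intervals.
    separated : ∀ u v → N ∤ rep u * rep v → N ∤ gcd (rep u) N * gcd (rep u) N →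
                Overlap L R′ u v → u ≡ v
    separated u v ∤uv ∤dd o = lookup-injective representatives-unique
      (placement-separates N (lookup-index d∈ds) ∤uv (placed i u) (placed i v)
        (proj₁ (o i)) (proj₂ (o i)))
      where
      d∈ds : gcd (rep u) N ∈ ds
      d∈ds = covers (gcd[m,n]∣n (rep u) N) (proj₂ (rep-isVertex u)) ∤dd
      i : Fin (length ds)
      i = Any.index d∈ds

    intervalModel : IsIntervalModel (IndexAdj Γ enumeration Adj?) L R′
    intervalModel = record
      { L≤R = λ i u → placement-≤ N (placed i u)
      ; adj⇔overlap = λ u v u≢v → mk⇔
          (λ (_ , uv≡0) i →
            let ∣uv = to (*≡0⇔∣ (rep u) (rep v)) uv≡0
                ∤dd = ∤squares (∈-lookup {xs = ds} i) in
            placement-overlap N ∤dd (rep-< u) ∣uv (placed i u) (placed i v) ,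
            placement-overlap N ∤dd (rep-< v) (subst (N ∣_) (*-comm (rep u) (rep v)) ∣uv)
              (placed i v) (placed i u))
          (λ o →
            (λ u≡v → u≢v (lookup-injective representatives-unique
              (≡ᴺ⇒≡ (rep-< u) (rep-< v) u≡v))) ,
            from (*≡0⇔∣ (rep u) (rep v))
              (decidable-stable (N ∣? (rep u * rep v)) (u≢v ∘ distinguish u v o)))
      }
      where
      distinguish : ∀ u v → Overlap L R′ u v → N ∤ rep u * rep v → u ≡ v
      distinguish u v o ∤uv
        with N ∣? gcd (rep u) N * gcd (rep u) N | N ∣? gcd (rep v) N * gcd (rep v) N
      ... | no ∤dd | _      = separated u v ∤uv ∤dd o
      ... | yes _  | no ∤ee = sym (separated v u (∤uv ∘ subst (N ∣_) (*-comm (rep v) (rep u))) ∤ee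
                                (λ i → proj₂ (o i) , proj₁ (o i)))
      -- Both `rep u` and `rep v` then have squares divisible by `N`, hence so is their product,
      -- against non-adjacency.
      ... | yes ∣dd | yes ∣ee = contradiction
        (∣m²∣n²⇒∣mn (rep u) (rep v) {{≢-nonZero (proj₁ (rep-isVertex u))}}
          (square (rep u) ∣dd) (square (rep v) ∣ee))
        ∤uv
        where
        square : ∀ x → N ∣ gcd x N * gcd x N → N ∣ x * x
        square x ∣dd = ∣-trans ∣dd (*-pres-∣ (gcd[m,n]∣m x N) (gcd[m,n]∣m x N))

    boxRepresentable : BoxRepresentable Γ (length ds)
    boxRepresentable = intervalModel⇒boxRepresentable Γ enumeration Adj? intervalModel

-- Counting the classes

ProperNonAnnihilator : ℕ → ℕ → Set
ProperNonAnnihilator N d = N ∤ d * d × d ≢ 1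

ProperNonAnnihilator? : ∀ N → Decidable (ProperNonAnnihilator N)
ProperNonAnnihilator? N d = ¬? (N ∣? (d * d)) ×-dec ¬? (d ≟ 1)

∣p²⇒ : ∀ {N p} → Prime p → N ∣ p * p → N ≡ 1 ⊎ N ≡ p ⊎ N ≡ p ^ 2
∣p²⇒ {N} {p} pp N∣pp with ∣p^k*m⇒split pp 2 (subst (N ∣_) p*p≡p^2*1 N∣pp)
  where
  p*p≡p^2*1 : p * p ≡ p ^ 2 * 1
  p*p≡p^2*1 = sym (trans (*-identityʳ (p ^ 2)) (cong (p *_) (*-identityʳ p)))
... | e , d , e≤2 , d∣1 , refl with ∣1⇒≡1 d∣1
∣p²⇒ {p = p} pp _ | 0 , .1 , _ , _ , refl | refl = inj₁ refl
∣p²⇒ {p = p} pp _ | 1 , .1 , _ , _ , refl | refl =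
  inj₂ (inj₁ (trans (*-identityʳ (p * 1)) (*-identityʳ p)))
∣p²⇒ {p = p} pp _ | 2 , .1 , _ , _ , refl | refl = inj₂ (inj₂ (*-identityʳ (p ^ 2)))
∣p²⇒ pp _ | suc (suc (suc _)) , .1 , s≤s (s≤s ()) , _ , refl | refl

prime-∣-value : ∀ s → PrimeBases s → value s ≢ 1 → ∃[ p ] (Prime p × p ∣ value s)
prime-∣-value [] _ 1≢1 = contradiction refl 1≢1
prime-∣-value ((p , zero) ∷ s) (_ ∷ ps) value≢1 =
  let r , pr , r∣ = prime-∣-value s ps (value≢1 ∘ trans (*-identityˡ (value s)))
  in r , pr , ∣n⇒∣m*n 1 r∣
prime-∣-value ((p , suc k) ∷ s) (pp ∷ _) _ =
  p , pp , ∣m⇒∣m*n (value s) (m∣m*n (p ^ k))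

value≢0 : ∀ s → PrimeBases s → NonZero (value s)
value≢0 [] [] = _
value≢0 ((p , k) ∷ s) (pp ∷ ps) = m*n≢0 _ _ {{m^n≢0 p k {{prime⇒nonZero pp}}}} {{value≢0 s ps}}

-- The bound is stated additively, which avoids truncated subtraction.
boxicity-bound : ∀ s → PrimeBases s → Composite (value s) →
  ¬ (∃[ p ] (Prime p × value s ≡ p ^ 2)) →
  ∃[ d ] (IsBoxicity (zeroDivisorGraph (ℤ/ (value s))) d ×
          d + suc (#annihilators s) ≤ #divisors s)
boxicity-bound s ps N-composite ≢p² = bound
  (boxicity-≤ Γ enumeration Adj? 1≤#classes (boxRepresentable classes
    (proj₁ ∘ proj₂ ∘ ∈-filter⁻ (ProperNonAnnihilator? N) {xs = nonAnnihilators s})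
    covers))
  where
  N : ℕ
  N = value s

  instance
    N≢0 : NonZero N
    N≢0 = value≢0 s ps

  open ZeroDivisors N

  N≢1 : N ≢ 1
  N≢1 = nonTrivial⇒≢1 {{composite⇒nonTrivial N-composite}}

  classes : List ℕ
  classes = filter (ProperNonAnnihilator? N) (nonAnnihilators s)

  covers : ∀ {d} → d ∣ N → d ≢ 1 → N ∤ d * d → d ∈ classes
  covers d∣N d≢1 ∤dd = ∈-filter⁺ (ProperNonAnnihilator? N) (∈-nonAnnihilators ps d∣N ∤dd) (∤dd , d≢1)

  -- Boxicity is positive, so at least one coordinate is required. A prime divisor `p` of `N`
  -- supplies a class: `N ∣ p * p` would make `N` equal to 1, `p` or `p ^ 2`. In the excluded case
  -- `p ^ 2` the bound would be `3 - 2 - 1 = 0`.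
  1≤#classes : 1 ≤ length classes
  1≤#classes with prime-∣-value s ps N≢1
  ... | p , pp , p∣N = nonEmpty (covers p∣N (nonTrivial⇒≢1 {{prime⇒nonTrivial pp}}) ∤pp)
    where
    nonEmpty : ∀ {x : ℕ} {xs} → x ∈ xs → 1 ≤ length xs
    nonEmpty {xs = _ ∷ _} _ = s≤s z≤n

    ∤pp : N ∤ p * p
    ∤pp ∣pp with ∣p²⇒ pp ∣pp
    ... | inj₁ N≡1         = N≢1 N≡1
    ... | inj₂ (inj₁ N≡p)  = composite⇒¬prime N-composite (subst Prime (sym N≡p) pp)
    ... | inj₂ (inj₂ N≡p²) = ≢p² (p , pp , N≡p²)

  -- The divisor 1 is among the non-annihilators, as `N` is not 1, and the filter removes it. This
  -- is the final `- 1` of the bound.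
  #classes< : length classes < length (nonAnnihilators s)
  #classes< = filter-notAll (ProperNonAnnihilator? N) (nonAnnihilators s)
    (lose (∈-nonAnnihilators ps (1∣ N) (N≢1 ∘ ∣1⇒≡1)) λ (_ , 1≢1) → 1≢1 refl)

  bound : ∃[ d ] (IsBoxicity Γ d × d ≤ length classes) →
          ∃[ d ] (IsBoxicity Γ d × d + suc (#annihilators s) ≤ #divisors s)
  bound (d , isBox , d≤) = d , isBox , (begin
    d + suc (#annihilators s)                    ≡⟨ +-suc d _ ⟩
    suc d + #annihilators s                      ≤⟨ +-monoˡ-≤ _ (≤-<-trans d≤ #classes<) ⟩
    length (nonAnnihilators s) + #annihilators s ≡⟨ length-nonAnnihilators s ⟩
    #divisors s                                  ∎)
    where open ≤-Reasoning

-- Passing to the products over even and odd exponents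

product-map-tabulate-++ : ∀ {A : Set} {a b} (h : A → ℕ) (f : Fin a → A) (g : Fin b → A) →
  product (map h (tabulate f ++ tabulate g)) ≡ ∏ (h ∘ f) * ∏ (h ∘ g)
product-map-tabulate-++ h f g = trans
  (cong product (trans (map-++ h (tabulate f) (tabulate g))
    (cong₂ _++_ (map-tabulate f h) (map-tabulate g h))))
  (product-++ (tabulate (h ∘ f)) (tabulate (h ∘ g)))

∏-cong : ∀ {n} {f g : Fin n → ℕ} → (∀ i → f i ≡ g i) → ∏ f ≡ ∏ g
∏-cong f≡g = cong product (tabulate-cong f≡g)

⌊2n/2⌋≡n : ∀ n → ⌊ 2 * n /2⌋ ≡ n
⌊2n/2⌋≡n n = trans (cong (λ k → ⌊ n + k /2⌋) (+-identityʳ n)) (sym (n≡⌊n+n/2⌋ n))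

⌊2n+1/2⌋≡n : ∀ n → ⌊ 2 * n + 1 /2⌋ ≡ n
⌊2n+1/2⌋≡n zero    = refl
⌊2n+1/2⌋≡n (suc n) = trans (cong (λ k → ⌊ k + 1 /2⌋) (*-suc 2 n)) (cong suc (⌊2n+1/2⌋≡n n))

+-≤⇒≤-minus : ∀ d {m k} → d + suc m ≤ k → + d ℤ.≤ + k ℤ.- + m ℤ.- 1ℤ
+-≤⇒≤-minus d {m} {k} d+1+m≤k = subst₂ ℤ._≤_ (cancel (+ d) (+ m)) (regroup (+ k) (+ m))
  (ℤ.+-monoˡ-≤ (ℤ.- (1ℤ ℤ.+ + m)) (ℤ.+≤+ d+1+m≤k))
  where
  cancel : ∀ d m → (d ℤ.+ (1ℤ ℤ.+ m)) ℤ.+ ℤ.- (1ℤ ℤ.+ m) ≡ d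
  cancel = solve-∀
  regroup : ∀ k m → k ℤ.+ ℤ.- (1ℤ ℤ.+ m) ≡ k ℤ.- m ℤ.- 1ℤ
  regroup = solve-∀

theorem5p2 : ∀ (N : ℕ) → Composite N →
    ¬ (∃[ p ] (Prime p × N ≡ p ^ 2)) →
    ∀ (a b : ℕ) (p n : Fin a → ℕ) (q m : Fin b → ℕ) →
    (∀ i → Prime (p i)) → (∀ j → Prime (q j)) →
    Injective _≡_ _≡_ [ p , q ] →
    (∀ i → 1 ≤ n i) →
    N ≡ ∏ (λ i → p i ^ (2 * n i)) * ∏ (λ j → q j ^ (2 * m j + 1)) →
    ∃[ d ] (IsBoxicity (zeroDivisorGraph (ℤ/ N)) d ×
    + d ℤ.≤ + (∏ (λ i → 2 * n i + 1) * ∏ (λ j → 2 * m j + 2))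
    ℤ.- + (∏ (λ i → n i + 1) * ∏ (λ j → m j + 1))
    ℤ.- 1ℤ)
theorem5p2 N N-composite ≢p² a b p n q m pp qp _ _ N≡ =
  let d , isBox , d≤ = boxicity-bound s
        (All.++⁺ (All.tabulate⁺ pp) (All.tabulate⁺ qp))
        (subst Composite N≡value N-composite)
        (λ (r , pr , eq) → ≢p² (r , pr , trans N≡value eq))
  in d , subst (λ N → IsBoxicity (zeroDivisorGraph (ℤ/ N)) d) (sym N≡value) isBox ,
     +-≤⇒≤-minus d (subst₂ (λ M D → d + suc M ≤ D) #annihilators≡ #divisors≡ d≤)
  where
  even : Fin a → ℕ × ℕ
  even i = p i , 2 * n i

  odd : Fin b → ℕ × ℕ
  odd j = q j , 2 * m j + 1

  s : Factors
  s = tabulate even ++ tabulate odd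

  N≡value : N ≡ value s
  N≡value = trans N≡ (sym (product-map-tabulate-++ _ even odd))

  #divisors≡ : #divisors s ≡ ∏ (λ i → 2 * n i + 1) * ∏ (λ j → 2 * m j + 2)
  #divisors≡ = trans (product-map-tabulate-++ _ even odd) (cong₂ _*_
    (∏-cong λ i → +-comm 1 (2 * n i))
    (∏-cong λ j → sym (+-suc (2 * m j) 1)))

  #annihilators≡ : #annihilators s ≡ ∏ (λ i → n i + 1) * ∏ (λ j → m j + 1)
  #annihilators≡ = trans (product-map-tabulate-++ _ even odd) (cong₂ _*_
    (∏-cong λ i → trans (cong suc (⌊2n/2⌋≡n (n i))) (+-comm 1 (n i)))
    (∏-cong λ j → trans (cong suc (⌊2n+1/2⌋≡n (m j))) (+-comm 1 (m j))))
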